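{- For all integers $k \ge 0$ and $\ell \ge 3$, there exists an integer $f(k,\ell) \ge 0$ such that the tournament $A_{f(k,\ell)}$ contains a subdigraph $S \subseteq A_{f(k,\ell)}$ with $\overrightarrow{\chi}(S) > k$ and $\mathrm{girth}(S) > \ell$.
   Context: All digraphs are finite. A tournament is a digraph with exactly one arc between every pair of distinct vertices (and no loops). Subdigraphs are not necessarily induced. For disjoint vertex sets (or vertices, or vertex-disjoint subdigraphs) $X, Y$, write $X \Rightarrow Y$ (equivalently $Y \Leftarrow X$) if $xy$ is an arc for all $x \in X$ and $y \in Y$. The tournaments $A_n$ are defined recursively: $A_0$ is the one-vertex tournament, and for $n \ge 1$, $A_n$ is the tournament made from $n$ vertex-disjoint copies $T_1, \dots, T_n$ of $A_{n-1}$ and $n+1$ additional vertices $v_0, \dots, v_n$ such that: $v_i \Leftarrow v_j$ (that is, $v_jv_i$ is an arc) and $v_i \Rightarrow T_j$ for all $0 \le i < j \le n$; $T_i \Rightarrow v_j$ for all $1 \le i \le j \le n$; and $T_i \Rightarrow T_j$ for all $1 \le i < j \le n$. The dichromatic number $\overrightarrow{\chi}(D)$ of a digraph $D$ is the least integer $k \ge 0$ such that the vertices of $D$ can be partitioned into $k$ sets each inducing an acyclic subdigraph (no directed cycle). The girth $\mathrm{girth}(D)$ of a digraph $D$ is the minimum size of a cycle in its underlying undirected graph ($+\infty$ if there is none). -}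

module Defs where

open import Data.Bool using (Bool; true; false; T; _∧_)
open import Data.Bool.Properties using (T?; T-∧)
open import Data.Fin as Fin using (Fin; zero; suc; toℕ)
open import Data.Fin.Properties as Finₚ using (+↔⊎; *↔×; 1↔⊤)
open import Data.Nat as ℕ using (ℕ; zero; suc; _+_; _*_; _≤_; _<_)
open import Data.Nat.DivMod using (_mod_)
open import Data.Nat.Properties as ℕₚ using (≤-<-connex; <⇒≱)
open import Data.Product using (Σ; Σ-syntax; ∃-syntax; _×_; _,_; proj₁; proj₂)
open import Data.Product.Function.Dependent.Propositional using (Σ-↔)
open import Data.Product.Function.NonDependent.Propositional using (_×-↔_)
open import Data.Sum using (_⊎_; inj₁; inj₂)
open import Data.Sum.Function.Propositional using (_⊎-↔_)
open import Function using (_↔_; mk↔ₛ′; Inverse; Equivalence; _∘_)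
open import Function.Construct.Composition using (_↔-∘_)
open import Function.Definitions using (Injective)
open import Function.Properties.Inverse using (↔-refl; ↔-sym)
open import Level using (0ℓ)
open import Relation.Binary using (Rel; Decidable; tri<; tri≈; tri>)
open import Relation.Binary.PropositionalEquality using (_≡_; _≢_; refl; cong)
open import Relation.Nullary using (¬_; yes; no; ⌊_⌋; contradiction)
open import Relation.Nullary.Decidable using (map′; toWitness)
open import Relation.Nullary.Construct.Add.Supremum public using (_⁺; [_]; ⊤⁺)
open import Relation.Binary.Construct.Add.Supremum.Strict ℕ._<_ public using (_<⁺_)

Finite : Set → Set
Finite A = ∃[ n ] (A ↔ Fin n)

record Digraph : Set₁ where
  infix 4 _⟶_ _⟶?_
  field
    Vertex : Set
    _⟶_    : Rel Vertex 0ℓ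
    _⟶?_   : Decidable _⟶_
    finite : Finite Vertex

  IsTournament : Set
  IsTournament =
    (∀ x → ¬ x ⟶ x) ×
    (∀ x y → x ≢ y → (x ⟶ y × ¬ y ⟶ x) ⊎ (y ⟶ x × ¬ x ⟶ y))

open Digraph using (Vertex; IsTournament)

-- Boolean membership keeps the type of vertices of a subdigraph free of
-- duplicates (T is proof-irrelevant).
record Subdigraph (D : Digraph) : Set where
  open Digraph D using (_⟶_)
  field
    vertex : Vertex D → Bool
    arc    : Vertex D → Vertex D → Bool
    source : ∀ {x y} → T (arc x y) → T (vertex x)
    target : ∀ {x y} → T (arc x y) → T (vertex y)
    sound  : ∀ {x y} → T (arc x y) → x ⟶ y

private
  Σ-step : ∀ {n} {P : Fin (suc n) → Set} →
           Σ (Fin (suc n)) P ↔ (P zero ⊎ Σ (Fin n) (P ∘ suc))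
  Σ-step = mk↔ₛ′
    (λ { (zero , p) → inj₁ p ; (suc i , p) → inj₂ (i , p) })
    (λ { (inj₁ p) → zero , p ; (inj₂ (i , p)) → suc i , p })
    (λ { (inj₁ _) → refl ; (inj₂ _) → refl })
    (λ { (zero , _) → refl ; (suc _ , _) → refl })

  T-finite : ∀ b → Finite (T b)
  T-finite true  = 1 , ↔-sym 1↔⊤
  T-finite false = 0 , mk↔ₛ′ (λ ()) (λ ()) (λ ()) (λ ())

  ⊎-finite : ∀ {A B} → Finite A → Finite B → Finite (A ⊎ B)
  ⊎-finite (m , e) (n , f) = m + n , ↔-sym +↔⊎ ↔-∘ (e ⊎-↔ f)

  ×-finite : ∀ {A B} → Finite A → Finite B → Finite (A × B)
  ×-finite (m , e) (n , f) = m * n , ↔-sym *↔× ↔-∘ (e ×-↔ f)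

  ↔-finite : ∀ {A B} → A ↔ B → Finite B → Finite A
  ↔-finite e (n , f) = n , f ↔-∘ e

  ΣFin-finite : ∀ n (P : Fin n → Bool) → Finite (Σ (Fin n) (T ∘ P))
  ΣFin-finite zero    P = 0 , mk↔ₛ′ (λ ()) (λ ()) (λ ()) (λ ())
  ΣFin-finite (suc n) P =
    ↔-finite Σ-step (⊎-finite (T-finite (P zero)) (ΣFin-finite n (P ∘ suc)))

  subset-finite : ∀ {A} → Finite A → (P : A → Bool) → Finite (Σ A (T ∘ P))
  subset-finite (n , e) P =
    ↔-finite (↔-sym (Σ-↔ (↔-sym e) ↔-refl)) (ΣFin-finite n (P ∘ Inverse.from e))

⟦_⟧ : ∀ {D} → Subdigraph D → Digraph
⟦_⟧ {D} S = record
  { Vertex = Σ[ x ∈ Vertex D ] T (vertex x)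
  ; _⟶_    = λ x y → T (arc (proj₁ x) (proj₁ y))
  ; _⟶?_   = λ x y → T? (arc (proj₁ x) (proj₁ y))
  ; finite = subset-finite (Digraph.finite D) vertex
  }
  where open Subdigraph S

induced : (D : Digraph) → (Vertex D → Bool) → Subdigraph D
induced D X = record
  { vertex = X
  ; arc    = λ x y → (X x ∧ X y) ∧ ⌊ x ⟶? y ⌋
  ; source = λ a → proj₁ (split (proj₁ (split a)))
  ; target = λ {x} a → proj₂ (split {X x} (proj₁ (split a)))
  ; sound  = λ {x} {y} a → toWitness {a? = x ⟶? y} (proj₂ (split {X x ∧ X y} a))
  }
  where
  open Digraph D
  split : ∀ {a b} → T (a ∧ b) → T a × T b
  split = Equivalence.to T-∧

next : ∀ {m} → Fin m → Fin m
next {suc m} i = suc (toℕ i) mod suc m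

record Cycle {V : Set} (R : Rel V 0ℓ) (m : ℕ) : Set where
  field
    at       : Fin m → V
    distinct : Injective _≡_ _≡_ at
    step     : ∀ i → R (at i) (at (next i))

-- Loops and digons count as directed cycles.
Acyclic : Digraph → Set
Acyclic D = ∀ m → 1 ≤ m → ¬ Cycle (Digraph._⟶_ D) m

Adjacent : (D : Digraph) → Rel (Vertex D) 0ℓ
Adjacent D x y = x ⟶ y ⊎ y ⟶ x
  where open Digraph D

UnderlyingCycle : Digraph → ℕ → Set
UnderlyingCycle D m = 3 ≤ m × Cycle (Adjacent D) m

IsLeast : (ℕ → Set) → ℕ → Set
IsLeast P n = P n × (∀ m → P m → n ≤ m)

-- Part i consists of the vertices mapped to i; parts may be empty, which does
-- not affect the least possible number of parts.
AcyclicPartition : Digraph → ℕ → Set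
AcyclicPartition D k =
  Σ[ part ∈ (Vertex D → Fin k) ]
    ∀ i → Acyclic ⟦ induced D (λ x → ⌊ part x Fin.≟ i ⌋) ⟧

IsDichromaticNumber : Digraph → ℕ → Set
IsDichromaticNumber D = IsLeast (AcyclicPartition D)

data IsGirth (D : Digraph) : ℕ ⁺ → Set where
  finite   : ∀ {g} → IsLeast (UnderlyingCycle D) g → IsGirth D [ g ]
  infinite : (∀ m → ¬ UnderlyingCycle D m) → IsGirth D ⊤⁺

-- For n = suc m, inT i x is the vertex x of the copy T_(toℕ i + 1) of A m
-- (copies are numbered 1, …, n), and v i is the additional vertex v_(toℕ i).
data AVertex : ℕ → Set where
  root : AVertex 0
  inT  : ∀ {m} → Fin (suc m) → AVertex m → AVertex (suc m)
  v    : ∀ {m} → Fin (2 + m) → AVertex (suc m)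

copyIndex : ∀ {m} → Fin m → ℕ
copyIndex i = suc (toℕ i)

infix 4 _⟶ᴬ_ _⟶ᴬ?_

data _⟶ᴬ_ : ∀ {n} → AVertex n → AVertex n → Set where
  v⟶v    : ∀ {m} {i j : Fin (2 + m)} → toℕ i < toℕ j → v j ⟶ᴬ v i
  v⟶T    : ∀ {m} {i : Fin (2 + m)} {j x} → toℕ i < copyIndex j → v i ⟶ᴬ inT j x
  T⟶v    : ∀ {m} {i x} {j : Fin (2 + m)} → copyIndex i ≤ toℕ j → inT i x ⟶ᴬ v j
  T⟶T    : ∀ {m} {i j : Fin (suc m)} {x y} →
           copyIndex i < copyIndex j → inT i x ⟶ᴬ inT j y
  inside : ∀ {m} {i : Fin (suc m)} {x y} → x ⟶ᴬ y → inT i x ⟶ᴬ inT i y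

_⟶ᴬ?_ : ∀ {n} → Decidable (_⟶ᴬ_ {n})
root    ⟶ᴬ? root    = no λ ()
v j     ⟶ᴬ? v i     = map′ v⟶v (λ { (v⟶v p) → p }) (toℕ i ℕ.<? toℕ j)
v i     ⟶ᴬ? inT j x = map′ v⟶T (λ { (v⟶T p) → p }) (toℕ i ℕ.<? copyIndex j)
inT i x ⟶ᴬ? v j     = map′ T⟶v (λ { (T⟶v p) → p }) (copyIndex i ℕ.≤? toℕ j)
inT i x ⟶ᴬ? inT j y with Finₚ.<-cmp i j
... | tri< i<j _ _    = yes (T⟶T (ℕ.s≤s i<j))
... | tri> i≮j i≢j _  = no λ { (T⟶T (ℕ.s≤s p)) → i≮j p ; (inside _) → i≢j refl }
... | tri≈ i≮j refl _ =
  map′ inside (λ { (T⟶T (ℕ.s≤s p)) → contradiction p i≮j ; (inside a) → a }) (x ⟶ᴬ? y)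

AVertex-finite : ∀ n → Finite (AVertex n)
AVertex-finite zero = 1 , mk↔ₛ′ (λ _ → zero) (λ _ → root) (λ { zero → refl }) (λ { root → refl })
AVertex-finite (suc m) = ↔-finite unfold
  (⊎-finite (×-finite (suc m , ↔-refl) (AVertex-finite m)) (2 + m , ↔-refl))
  where
  unfold : AVertex (suc m) ↔ ((Fin (suc m) × AVertex m) ⊎ Fin (2 + m))
  unfold = mk↔ₛ′
    (λ { (inT i x) → inj₁ (i , x) ; (v i) → inj₂ i })
    (λ { (inj₁ (i , x)) → inT i x ; (inj₂ i) → v i })
    (λ { (inj₁ _) → refl ; (inj₂ _) → refl })
    (λ { (inT _ _) → refl ; (v _) → refl })

A : ℕ → Digraph
A n = record
  { Vertex = AVertex n
  ; _⟶_    = _⟶ᴬ_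
  ; _⟶?_   = _⟶ᴬ?_
  ; finite = AVertex-finite n
  }

A-isTournament : ∀ n → IsTournament (A n)
A-isTournament n = irrefl , exactlyOne
  where
  irrefl : ∀ {n} (x : AVertex n) → ¬ x ⟶ᴬ x
  irrefl (v _)     (v⟶v p)    = ℕₚ.<-irrefl refl p
  irrefl (inT _ _) (T⟶T p)    = ℕₚ.<-irrefl refl p
  irrefl (inT _ x) (inside a) = irrefl x a

  exactlyOne : ∀ {n} (x y : AVertex n) → x ≢ y →
               (x ⟶ᴬ y × ¬ y ⟶ᴬ x) ⊎ (y ⟶ᴬ x × ¬ x ⟶ᴬ y)
  exactlyOne root root x≢y = contradiction refl x≢y
  exactlyOne (v i) (v j) x≢y with Finₚ.<-cmp i j
  ... | tri< i<j _ i≯j  = inj₂ (v⟶v i<j , λ { (v⟶v p) → i≯j p })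
  ... | tri≈ _ refl _   = contradiction refl x≢y
  ... | tri> i≮j _ i>j  = inj₁ (v⟶v i>j , λ { (v⟶v p) → i≮j p })
  exactlyOne (v i) (inT j x) _ with ≤-<-connex (copyIndex j) (toℕ i)
  ... | inj₁ j≤i = inj₂ (T⟶v j≤i , λ { (v⟶T p) → <⇒≱ p j≤i })
  ... | inj₂ i<j = inj₁ (v⟶T i<j , λ { (T⟶v p) → <⇒≱ i<j p })
  exactlyOne (inT i x) (v j) _ with ≤-<-connex (copyIndex i) (toℕ j)
  ... | inj₁ i≤j = inj₁ (T⟶v i≤j , λ { (v⟶T p) → <⇒≱ p i≤j })
  ... | inj₂ j<i = inj₂ (v⟶T j<i , λ { (T⟶v p) → <⇒≱ j<i p })
  exactlyOne (inT i x) (inT j y) x≢y with Finₚ.<-cmp i j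
  ... | tri< i<j i≢j i≯j =
    inj₁ (T⟶T (ℕ.s≤s i<j) , λ { (T⟶T (ℕ.s≤s p)) → i≯j p ; (inside _) → i≢j refl })
  ... | tri> i≮j i≢j i>j =
    inj₂ (T⟶T (ℕ.s≤s i>j) , λ { (T⟶T (ℕ.s≤s p)) → i≮j p ; (inside _) → i≢j refl })
  ... | tri≈ i≮i refl _ with exactlyOne x y (x≢y ∘ cong (inT i))
  ...   | inj₁ (a , ¬b) =
    inj₁ (inside a , λ { (T⟶T (ℕ.s≤s p)) → i≮i p ; (inside b) → ¬b b })
  ...   | inj₂ (a , ¬b) =
    inj₂ (inside a , λ { (T⟶T (ℕ.s≤s p)) → i≮i p ; (inside b) → ¬b b })

module Submission where

-- A system over n parts is an n-partite hypergraph whose edges carry colourings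
-- of their n vertices, such that every K-colouring of all vertices agrees with
-- the carried one on some edge.  A double induction (on the girth and on n)
-- gives such systems without short cycles.  Take the parts to be the vertices
-- of a tournament A m in which every K-colouring has a monochromatic directed
-- cycle of length ℓ + 1, and keep, on each edge, only the cycle that is
-- monochromatic for the carried colouring.  The union of these cycles has girth
-- ℓ + 1, is not K-colourable, and lies in a blow-up of A m, hence in a larger
-- A n.  It has dichromatic number exactly K + 1, as it uses only K + 1 levels of
-- the recursion and each level of A n is acyclic.

open import Defs
open import Data.Bool using (true; T; _∧_)
open import Data.Bool.Properties using (T-∧)
open import Data.Fin as Fin using
  (Fin; zero; suc; toℕ; fromℕ<; inject≤; inject₁; combine; opposite; punchIn; punchOut;
   finToFun; funToFin)
open import Data.Fin.Properties using
  (toℕ-injective; toℕ-fromℕ<; toℕ<n; toℕ-inject≤; toℕ-combine; any?; inj⇒≟; finToFun-funToFin;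
   *↔×; +↔⊎; 1↔⊤; opposite-prop; punchIn-punchOut; combine-injective; inject≤-injective;
   fromℕ<-injective; inject₁-injective)
open import Data.Nat using
  (ℕ; zero; suc; pred; _+_; _*_; _^_; _∸_; _≤_; _<_; z≤n; s≤s; z<s; s<s; s≤s⁻¹)
open import Data.Nat.DivMod using
  (_%_; _/_; m≡m%n+[m/n]*n; m<n⇒m%n≡m; m%n%n≡m%n; n%n≡0; m*n%n≡0; %-distribˡ-+; [m+kn]%n≡m%n;
   m%n<n)
open import Data.Nat.GeneralisedArithmetic using (fold)
open import Data.Nat.Properties
open import Data.Product using (Σ-syntax; ∃-syntax; _×_; _,_; proj₁; proj₂)
open import Data.Product.Function.NonDependent.Propositional using (_×-↔_)
open import Data.Product.Properties using (,-injectiveˡ; ,-injectiveʳ)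
open import Data.Sum using (_⊎_; inj₁; inj₂)
open import Data.Sum.Function.Propositional using (_⊎-↔_)
open import Data.Sum.Properties using (inj₁-injective; inj₂-injective)
open import Data.Unit using (⊤; tt)
open import Function using (_∘_; Equivalence; Inverse)
open import Function.Construct.Composition using (_↔-∘_)
open import Function.Definitions using (Injective)
open import Function.Properties.Inverse using (↔⇒↣; ↔-refl; ↔-sym)
open import Relation.Binary using (DecidableEquality; Transitive)
import Relation.Binary.Construct.Add.Supremum.Strict _<_ as Strict
open import Relation.Binary.PropositionalEquality
open import Relation.Nullary using (¬_; Dec; yes; no; contradiction; ⌊_⌋)
open import Relation.Nullary.Decidable using
  (map′; recompute; toWitness; fromWitness; _×-dec_)
open import Relation.Unary using (Decidable)

-- Decidability on finite types

finite⇒≟ : ∀ {X} → Finite X → DecidableEquality X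
finite⇒≟ (_ , e) = inj⇒≟ (↔⇒↣ e)

finite⇒∃? : ∀ {X} → Finite X → {P : X → Set} → Decidable P → Dec (∃[ x ] P x)
finite⇒∃? (_ , e) {P} P? = map′
  (λ (i , p) → Inverse.from e i , p)
  (λ (x , p) → Inverse.to e x , subst P (sym (Inverse.strictlyInverseʳ e x)) p)
  (any? (P? ∘ Inverse.from e))

×-finite : ∀ {X Y} → Finite X → Finite Y → Finite (X × Y)
×-finite (m , e) (n , f) = m * n , ↔-sym *↔× ↔-∘ (e ×-↔ f)

⊎-finite : ∀ {X Y} → Finite X → Finite Y → Finite (X ⊎ Y)
⊎-finite (m , e) (n , f) = m + n , ↔-sym +↔⊎ ↔-∘ (e ⊎-↔ f)

-- Rotations of a cycle

rotate : ∀ {n} → ℕ → Fin n → Fin n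
rotate b i = fold i next b

toℕ-next : ∀ {n} (i : Fin (suc n)) → toℕ (next i) ≡ suc (toℕ i) % suc n
toℕ-next {n} i = toℕ-fromℕ< (m%n<n (suc (toℕ i)) (suc n))

next-< : ∀ {n} (i : Fin (suc n)) → toℕ i < n → toℕ (next i) ≡ suc (toℕ i)
next-< i i<n = trans (toℕ-next i) (m<n⇒m%n≡m (s<s i<n))

next-last : ∀ {n} (i : Fin (suc n)) → toℕ i ≡ n → next i ≡ zero
next-last {n} i eq = toℕ-injective
  (trans (toℕ-next i) (trans (cong (λ a → suc a % suc n) eq) (n%n≡0 (suc n))))

toℕ-rotate : ∀ {n} b (i : Fin (suc n)) → toℕ (rotate b i) ≡ (b + toℕ i) % suc n
toℕ-rotate zero i = sym (m<n⇒m%n≡m (toℕ<n i))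
toℕ-rotate {n} (suc b) i = begin
  toℕ (next (rotate b i))                         ≡⟨ toℕ-next (rotate b i) ⟩
  suc (toℕ (rotate b i)) % suc n                  ≡⟨ cong (λ a → suc a % suc n) (toℕ-rotate b i) ⟩
  (1 + (b + toℕ i) % suc n) % suc n               ≡⟨ %-distribˡ-+ 1 ((b + toℕ i) % suc n) (suc n) ⟩
  (1 % suc n + (b + toℕ i) % suc n % suc n) % suc n
    ≡⟨ cong (λ a → (1 % suc n + a) % suc n) (m%n%n≡m%n (b + toℕ i) (suc n)) ⟩
  (1 % suc n + (b + toℕ i) % suc n) % suc n       ≡⟨ %-distribˡ-+ 1 (b + toℕ i) (suc n) ⟨
  suc (b + toℕ i) % suc n                         ∎
  where open ≡-Reasoning

rotate-full : ∀ {n} (i : Fin n) → rotate n i ≡ i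
rotate-full {suc n} i = toℕ-injective (begin
  toℕ (rotate (suc n) i)          ≡⟨ toℕ-rotate (suc n) i ⟩
  (suc n + toℕ i) % suc n         ≡⟨ cong (_% suc n) (+-comm (suc n) (toℕ i)) ⟩
  (toℕ i + suc n) % suc n         ≡⟨ cong (λ a → (toℕ i + a) % suc n) (*-identityˡ (suc n)) ⟨
  (toℕ i + 1 * suc n) % suc n     ≡⟨ [m+kn]%n≡m%n (toℕ i) 1 (suc n) ⟩
  toℕ i % suc n                   ≡⟨ m<n⇒m%n≡m (toℕ<n i) ⟩
  toℕ i                           ∎)
  where open ≡-Reasoning

-- If `rotate b` fixed `i`, then `n` would divide `b`, which lies strictly between 0 and `n`.
rotate-moves : ∀ {n b} (i : Fin n) → 1 ≤ b → b < n → rotate b i ≢ i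
rotate-moves {suc n} {b} i 1≤b b<n eq = <⇒≢ 1≤b (sym (begin
  b                                ≡⟨ m<n⇒m%n≡m b<n ⟨
  b % suc n                        ≡⟨ cong (_% suc n) b≡qn ⟩
  ((b + toℕ i) / suc n * suc n) % suc n ≡⟨ m*n%n≡0 ((b + toℕ i) / suc n) (suc n) ⟩
  0                                ∎))
  where
  open ≡-Reasoning
  b≡qn : b ≡ (b + toℕ i) / suc n * suc n
  b≡qn = +-cancelˡ-≡ (toℕ i) _ _ (begin
    toℕ i + b                                               ≡⟨ +-comm (toℕ i) b ⟩
    b + toℕ i                                               ≡⟨ m≡m%n+[m/n]*n (b + toℕ i) (suc n) ⟩
    (b + toℕ i) % suc n + (b + toℕ i) / suc n * suc n
      ≡⟨ cong (_+ (b + toℕ i) / suc n * suc n) (trans (sym (toℕ-rotate b i)) (cong toℕ eq)) ⟩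
    toℕ i + (b + toℕ i) / suc n * suc n                     ∎)

rotate-next : ∀ {n} b (i : Fin n) → rotate b (next i) ≡ next (rotate b i)
rotate-next zero    i = refl
rotate-next (suc b) i = cong next (rotate-next b i)

next-injective : ∀ {n} {i j : Fin n} → next i ≡ next j → i ≡ j
next-injective {suc n} {i} {j} eq = begin
  i                   ≡⟨ rotate-full i ⟨
  next (rotate n i)   ≡⟨ rotate-next n i ⟨
  rotate n (next i)   ≡⟨ cong (rotate n) eq ⟩
  rotate n (next j)   ≡⟨ rotate-next n j ⟩
  next (rotate n j)   ≡⟨ rotate-full j ⟩
  j                   ∎
  where open ≡-Reasoning

-- Going once round the cycle, transitivity puts the image of the starting point strictly below
-- itself.
noCycle : ∀ {V V′ : Set} {R : V → V → Set} {_≺_ : V′ → V′ → Set} →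
          Transitive _≺_ → (∀ x → ¬ x ≺ x) →
          (f : V → V′) → (∀ {x y} → R x y → f x ≺ f y) → ∀ {m} → 1 ≤ m → ¬ Cycle R m
noCycle {_≺_ = _≺_} ≺-trans ≺-irrefl f f-hom {suc m} _ Z =
  ≺-irrefl (f (at zero)) (subst (λ i → f (at zero) ≺ f (at i)) (rotate-full zero) (ascend m))
  where
  open Cycle Z
  ascend : ∀ b → f (at zero) ≺ f (at (rotate (suc b) zero))
  ascend zero    = f-hom (step zero)
  ascend (suc b) = ≺-trans (ascend b) (f-hom (step (rotate (suc b) zero)))

-- Sparse systems

module _ {W X : Set} (_∋_ : W → X → Set) where

  -- Walk w w′ x s: a walk w , x₁ , w₁ , … , x , w′ in the incidence graph with
  -- s intermediate elements of X and without immediate backtracking.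
  data Walk (w : W) : W → X → ℕ → Set where
    start  : ∀ {w′ x} → w ∋ x → w′ ∋ x → w ≢ w′ → Walk w w′ x 1
    extend : ∀ {w′ w″ x x′ s} → Walk w w′ x s → x ≢ x′ →
             w′ ∋ x′ → w″ ∋ x′ → w′ ≢ w″ → Walk w w″ x′ (suc s)

  -- Equivalently, the incidence graph has no cycle of length at most `2ℓ`. Backtracking where the
  -- walk closes up at `w` is allowed; cutting off such a tail leaves a shorter closed walk.
  Sparse : ℕ → Set
  Sparse ℓ = ∀ {w x s} → s ≤ ℓ → ¬ Walk w w x s

walk-nonempty : ∀ {W X} {_∋_ : W → X → Set} {w w′ x s} → Walk _∋_ w w′ x s → 1 ≤ s
walk-nonempty (start _ _ _)        = s≤s z≤n
walk-nonempty (extend _ _ _ _ _) = s≤s z≤n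

-- Vertices are pairs of a part and a node, so parts are disjoint although they share the type of
-- nodes.
Occurs : ∀ {W N : Set} {n} → (W → Fin n → N) → W → Fin n × N → Set
Occurs node w (i , p) = node w i ≡ p

-- An n-partite hypergraph with edges w = { (i , node w i) ∣ i < n }, each
-- carrying a colouring of its n vertices, such that every colouring of all
-- vertices agrees on some edge with the colouring carried by that edge.
record System (K ℓ n : ℕ) : Set₁ where
  field
    Word Node   : Set
    word-finite : Finite Word
    node-finite : Finite Node
    node        : Word → Fin n → Node
    colour      : Word → Fin n → Fin K
    realise     : ∀ (f : Fin n → Node → Fin K) → ∃[ w ] (∀ i → f i (node w i) ≡ colour w i)
    sparse      : Sparse (Occurs node) ℓ

⊤-finite : Finite ⊤
⊤-finite = 1 , ↔-sym 1↔⊤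

-- With one vertex per part and all colourings as words, every colouring is its own witness.
oneNode : ∀ K n → System K 1 n
oneNode K n = record
  { Word = Fin (K ^ n) ; Node = ⊤
  ; word-finite = K ^ n , ↔-refl ; node-finite = ⊤-finite
  ; node = λ _ _ → tt ; colour = finToFun
  ; realise = λ f → funToFin (λ i → f i tt) , λ i → sym (finToFun-funToFin (λ i → f i tt) i)
  ; sparse = λ where
      _         (start _ _ w≢w)    → w≢w refl
      (s≤s s≤0) (extend W _ _ _ _) → <⇒≱ (walk-nonempty W) s≤0
  }

noParts : ∀ K ℓ → System K ℓ 0
noParts K ℓ = record
  { Word = ⊤ ; Node = ⊤ ; word-finite = ⊤-finite ; node-finite = ⊤-finite
  ; node = λ _ () ; colour = λ _ () ; realise = λ _ → tt , λ ()
  ; sparse = λ { _ (start {x = () , _} _ _ _) ; _ (extend {x′ = () , _} _ _ _ _ _) }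
  }

-- Every word u of X carries its own copy of Y, and the new vertex of a word
-- (u , y) is the vertex of u in the part numbered by y.  A closed walk either
-- stays in one copy of Y, or projects to a closed walk of X about half as long.
module Amalgam {K ℓ n : ℕ} (Y : System K (2 + ℓ) n)
               (X : System K (1 + ℓ) (proj₁ (System.word-finite Y))) where
  module X = System X
  module Y = System Y

  private
    part = Inverse.to (proj₂ Y.word-finite)
    unpart = Inverse.from (proj₂ Y.word-finite)

    part-injective : ∀ {y y′} → part y ≡ part y′ → y ≡ y′
    part-injective {y} {y′} eq = trans (sym (Inverse.strictlyInverseʳ (proj₂ Y.word-finite) y))
      (trans (cong unpart eq) (Inverse.strictlyInverseʳ (proj₂ Y.word-finite) y′))

  Word Node : Set
  Word = X.Word × Y.Word
  Node = (Fin (proj₁ Y.word-finite) × X.Node) ⊎ (X.Word × Y.Node)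

  node : Word → Fin (suc n) → Node
  node (u , y) zero    = inj₁ (part y , X.node u (part y))
  node (u , y) (suc i) = inj₂ (u , Y.node y i)

  colour : Word → Fin (suc n) → Fin K
  colour (u , y) zero    = X.colour u (part y)
  colour (u , y) (suc i) = Y.colour y i

  realise : ∀ (f : Fin (suc n) → Node → Fin K) → ∃[ w ] (∀ i → f i (node w i) ≡ colour w i)
  -- `X` comes first: its word `u` makes the new vertices of `(u , y)` correct for all `y` at once,
  -- so `Y` may then choose `y` freely in the copy of `u`.
  realise f with X.realise (λ j p → f zero (inj₁ (j , p)))
  ... | u , u-ok with Y.realise (λ i q → f (suc i) (inj₂ (u , q)))
  ...   | y , y-ok = (u , y) , λ { zero → u-ok (part y) ; (suc i) → y-ok i }

  -- The part of a walk from u₀ , y₀ to u , y lying in the last copy of Y, as a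
  -- walk from y₁ to y with b steps whose last vertex, if any, is the given one.
  data InCopy (u : X.Word) : Y.Word → Y.Word → Fin (suc n) × Node → ℕ → Set where
    here : ∀ {y} → InCopy u y y (zero , inj₁ (part y , X.node u (part y))) 0
    walk : ∀ {y₁ y i q b} → Walk (Occurs Y.node) y₁ y (i , q) b →
           InCopy u y₁ y (suc i , inj₂ (u , q)) b

  -- A vertex of part zero determines `y`, so passing through it changes only `u` and is a step of
  -- the projected walk in `X`. Successive crossings are separated by a step inside a copy, hence
  -- `t + (t - 1) + b ≤ s`.
  data Shape (u₀ : X.Word) (y₀ : Y.Word) : Word → Fin (suc n) × Node → ℕ → Set where
    inside : ∀ {y i q s} → Walk (Occurs Y.node) y₀ y (i , q) s →
             Shape u₀ y₀ (u₀ , y) (suc i , inj₂ (u₀ , q)) s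
    across : ∀ {u y₁ y x t b s} →
             Walk (Occurs X.node) u₀ u (part y₁ , X.node u (part y₁)) t →
             InCopy u y₁ y x b → t + t + b ≤ suc s →
             Shape u₀ y₀ (u , y) x s

  private
    copy-short : ∀ t b {s} → 1 ≤ t → t + t + b ≤ suc s → b ≤ s
    copy-short t b 1≤t t+t+b≤ =
      s≤s⁻¹ (≤-trans (+-monoˡ-≤ b (≤-trans 1≤t (m≤m+n t t))) t+t+b≤)

    stay : ∀ t b {s} → t + t + b ≤ suc s → t + t + suc b ≤ suc (suc s)
    stay t b {s} t+t+b≤ = subst (_≤ suc (suc s)) (sym (+-suc (t + t) b)) (s≤s t+t+b≤)

    leave : ∀ t b {s} → 1 ≤ b → t + t + b ≤ suc s → suc t + suc t + 0 ≤ suc (suc s)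
    leave t b {s} 1≤b t+t+b≤ = begin
      suc t + suc t + 0   ≡⟨ +-identityʳ (suc t + suc t) ⟩
      suc (t + suc t)     ≡⟨ cong suc (+-suc t t) ⟩
      suc (suc (t + t))   ≡⟨ cong suc (+-comm (t + t) 1) ⟨
      suc (t + t + 1)     ≤⟨ s≤s (+-monoʳ-≤ (t + t) 1≤b) ⟩
      suc (t + t + b)     ≤⟨ s≤s t+t+b≤ ⟩
      suc (suc s)         ∎
      where open ≤-Reasoning

    project-short : ∀ t b {s} → s ≤ 2 + ℓ → t + t + b ≤ suc s → t ≤ 1 + ℓ
    project-short t b {s} s≤ t+t+b≤ = ≮⇒≥ λ 1+ℓ<t → <-irrefl refl (begin-strict
      3 + ℓ                 <⟨ +-monoʳ-≤ 2 (m≤n+m (2 + ℓ) ℓ) ⟩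
      (2 + ℓ) + (2 + ℓ)     ≤⟨ +-mono-≤ 1+ℓ<t 1+ℓ<t ⟩
      t + t                 ≤⟨ m≤m+n (t + t) b ⟩
      t + t + b             ≤⟨ t+t+b≤ ⟩
      suc s                 ≤⟨ s≤s s≤ ⟩
      3 + ℓ                 ∎)
      where open ≤-Reasoning

  extendShape : ∀ {u₀ y₀ w w′ x x′ s} → s ≤ 2 + ℓ → Shape u₀ y₀ w x s → x ≢ x′ →
                Occurs node w x′ → Occurs node w′ x′ → w ≢ w′ →
                Shape u₀ y₀ w′ x′ (suc s)
  extendShape {x′ = zero , _} _ (inside W) _ eq refl w≢w′
    with refl ← part-injective (,-injectiveˡ (inj₁-injective eq)) =
    across (start (,-injectiveʳ (inj₁-injective eq)) refl λ { refl → w≢w′ refl }) here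
           (s≤s (s≤s z≤n))
  -- A word has only one vertex in part zero, so crossings are never consecutive.
  extendShape {x′ = zero , _} _ (across V here _) x≢x′ eq refl _ =
    contradiction (cong (zero ,_) eq) x≢x′
  extendShape {x′ = zero , _} s≤ (across {t = t} {b} V (walk W) b≤) x≢x′ eq refl w≢w′
    with refl ← part-injective (,-injectiveˡ (inj₁-injective eq)) =
    across (extend V
              -- If successive crossings used the same vertex of `X`, the walk `W` between them
              -- would be closed in `Y`.
              (λ x≡x′ → Y.sparse (≤-trans (copy-short t b (walk-nonempty V) b≤) s≤)
                 (subst (λ y → Walk _ y _ _ _) (part-injective (,-injectiveˡ x≡x′)) W))
              (,-injectiveʳ (inj₁-injective eq)) refl λ { refl → w≢w′ refl })
           here (leave t b (walk-nonempty W) b≤)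
  extendShape {x′ = suc _ , _} _ (inside W) x≢x′ eq refl w≢w′
    with refl ← ,-injectiveˡ (inj₂-injective eq) =
    inside (extend W (λ { refl → x≢x′ refl }) (,-injectiveʳ (inj₂-injective eq)) refl
             λ { refl → w≢w′ refl })
  extendShape {x′ = suc _ , _} _ (across {t = t} V here b≤) _ eq refl w≢w′
    with refl ← ,-injectiveˡ (inj₂-injective eq) =
    across V (walk (start (,-injectiveʳ (inj₂-injective eq)) refl λ { refl → w≢w′ refl }))
           (stay t 0 b≤)
  extendShape {x′ = suc _ , _} _ (across {t = t} {b} V (walk W) b≤) x≢x′ eq refl w≢w′
    with refl ← ,-injectiveˡ (inj₂-injective eq) =
    across V (walk (extend W (λ { refl → x≢x′ refl }) (,-injectiveʳ (inj₂-injective eq)) refl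
                     λ { refl → w≢w′ refl }))
           (stay t b b≤)

  shape : ∀ {u₀ y₀ w x s} → s ≤ 2 + ℓ → Walk (Occurs node) (u₀ , y₀) w x s →
          Shape u₀ y₀ w x s
  shape _ (start {x = zero , _} eq refl w≢w′)
    with refl ← part-injective (,-injectiveˡ (inj₁-injective eq)) =
    across (start (,-injectiveʳ (inj₁-injective eq)) refl λ { refl → w≢w′ refl }) here
           (s≤s (s≤s z≤n))
  shape _ (start {x = suc _ , _} eq refl w≢w′)
    with refl ← ,-injectiveˡ (inj₂-injective eq) =
    inside (start (,-injectiveʳ (inj₂-injective eq)) refl λ { refl → w≢w′ refl })
  shape s≤ (extend W x≢x′ p q w≢w′) =
    extendShape (<⇒≤ s≤) (shape (<⇒≤ s≤) W) x≢x′ p q w≢w′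

  sparse : Sparse (Occurs node) (2 + ℓ)
  sparse s≤ W with shape s≤ W
  ... | inside V      = Y.sparse s≤ V
  ... | across {t = t} {b} V _ b≤ = X.sparse (project-short t b s≤ b≤) V

-- Lexicographic induction on `ℓ` and `n`: `X` has as many parts as `Y` has words, so the hypothesis
-- for smaller `ℓ` is used at an arbitrarily large number of parts.
system : ∀ K ℓ n → System K (suc ℓ) n
system K zero    n       = oneNode K n
system K (suc ℓ) zero    = noParts K (2 + ℓ)
system K (suc ℓ) (suc n) = amalgam (system K (suc ℓ) n) (system K ℓ _)
  where
  amalgam : (Y : System K (2 + ℓ) n) →
            System K (1 + ℓ) (proj₁ (System.word-finite Y)) → System K (2 + ℓ) (suc n)
  amalgam Y X = record
    { word-finite = ×-finite X.word-finite Y.word-finite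
    ; node-finite = ⊎-finite (×-finite (_ , ↔-refl) X.node-finite)
                             (×-finite X.word-finite Y.node-finite)
    ; Amalgam Y X
    }
    where
    module X = System X
    module Y = System Y

-- Monochromatic cycles in A n

mapCycle : ∀ {V V′ : Set} {R : V → V → Set} {R′ : V′ → V′ → Set} {m} (f : V → V′) →
           Injective _≡_ _≡_ f → (∀ {x y} → R x y → R′ (f x) (f y)) → Cycle R m → Cycle R′ m
mapCycle f f-inj f-hom C = record
  { at = f ∘ at ; distinct = distinct ∘ f-inj ; step = f-hom ∘ step }
  where open Cycle C

Increasing : ∀ {a n} → (Fin a → Fin n) → Set
Increasing h = ∀ {i j} → toℕ i < toℕ j → toℕ (h i) < toℕ (h j)

Selection : ∀ {n} → ℕ → (Fin n → Set) → Set
Selection {n} a P = Σ[ h ∈ (Fin a → Fin n) ] Increasing h × (∀ i → P (h i))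

skip : ∀ {n a} {P : Fin (suc n) → Set} → Selection a (P ∘ suc) → Selection a P
skip (h , h-inc , p) = suc ∘ h , s<s ∘ h-inc , p

take : ∀ {n a} {P : Fin (suc n) → Set} → P zero → Selection a (P ∘ suc) → Selection (suc a) P
take {P = P} p (h , h-inc , ps) = g , inc , gs
  where
  g : Fin _ → Fin _
  g zero    = zero
  g (suc i) = suc (h i)
  inc : Increasing g
  inc {zero}  {suc j} _       = z<s
  inc {suc i} {suc j} (s≤s p) = s<s (h-inc p)
  gs : ∀ i → P (g i)
  gs zero    = p
  gs (suc i) = ps i

dichotomy : ∀ a b {n} {P Q : Fin n → Set} → a + b ≤ n → (∀ i → P i ⊎ Q i) →
            Selection a P ⊎ Selection b Q
dichotomy zero    b       _ _ = inj₁ ((λ ()) , (λ { {()} }) , λ ())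
dichotomy (suc a) zero    _ _ = inj₂ ((λ ()) , (λ { {()} }) , λ ())
dichotomy (suc a) (suc b) {suc n} {P} {Q} a+b≤n d with d zero
... | inj₁ p with dichotomy a (suc b) (s≤s⁻¹ a+b≤n) (d ∘ suc)
...   | inj₁ s = inj₁ (take {P = P} p s)
...   | inj₂ s = inj₂ (skip {P = Q} s)
dichotomy (suc a) (suc b) {suc n} {P} {Q} a+b≤n d | inj₂ q
  with dichotomy (suc a) b (subst (_≤ n) (+-suc a b) (s≤s⁻¹ a+b≤n)) (d ∘ suc)
... | inj₁ s = inj₁ (skip {P = P} s)
... | inj₂ s = inj₂ (take {P = Q} q s)

-- Pigeonhole preserving the order: unless colour zero occurs `a` times, `k * a + 1` indices are
-- left for the other `k` colours.
monochromaticSelection : ∀ k a {n} → k * a < n → (f : Fin n → Fin k) →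
                         ∃[ c ] Selection a (λ i → f i ≡ c)
monochromaticSelection zero    a {suc n} _ f with () ← f zero
monochromaticSelection (suc k) a {n} ka<n f
  with dichotomy a (suc (k * a)) (subst (_≤ n) (sym (+-suc a (k * a))) ka<n) zeroOrSuc
  where
  zeroOrSuc : ∀ i → f i ≡ zero ⊎ ∃[ c ] f i ≡ suc c
  zeroOrSuc i with f i
  ... | zero  = inj₁ refl
  ... | suc c = inj₂ (c , refl)
... | inj₁ s = zero , s
... | inj₂ (h , h-inc , p) with monochromaticSelection k a ≤-refl (proj₁ ∘ p)
...   | c , h′ , h′-inc , q =
  suc c , h ∘ h′ , h-inc ∘ h′-inc , λ i → trans (proj₂ (p (h′ i))) (cong suc (q i))

-- The stage of the recursion that adds the vertex, in whichever copy it lies.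
level : ∀ {n} → AVertex n → ℕ
level root          = 0
level (inT _ x)     = level x
level (v {m = m} _) = suc m

level≤ : ∀ {n} (x : AVertex n) → level x ≤ n
level≤ root      = z≤n
level≤ (inT _ x) = m≤n⇒m≤1+n (level≤ x)
level≤ (v _)     = ≤-refl

someVertex : ∀ n → AVertex n
someVertex zero    = root
someVertex (suc n) = v zero

inT-injective : ∀ {m} {i j : Fin (suc m)} {x y} → inT i x ≡ inT j y → i ≡ j × x ≡ y
inT-injective refl = refl , refl

v-injective : ∀ {m} {i j : Fin (2 + m)} → v i ≡ v j → i ≡ j
v-injective refl = refl

_≺_ : ∀ {n} → AVertex n → AVertex n → Set
x ≺ y = x ⟶ᴬ y × level x ≡ level y

≺-irrefl : ∀ {n} (x : AVertex n) → ¬ x ≺ x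
≺-irrefl {n} x (x⟶x , _) = proj₁ (A-isTournament n) x x⟶x

level-inT≢v : ∀ {m} {i : Fin (suc m)} {x} → level (inT i x) ≢ suc m
level-inT≢v {x = x} eq = <⇒≢ (s≤s (level≤ x)) eq

-- Arcs between an additional vertex and a copy change the level. The remaining arcs follow the
-- order of the copies or reverse that of the `v i`.
≺-trans : ∀ {n} {x y z : AVertex n} → x ≺ y → y ≺ z → x ≺ z
≺-trans (v⟶v p , _) (v⟶v q , _) = v⟶v (<-trans q p) , refl
≺-trans (v⟶v p , _) (v⟶T {j = j} {x} _ , eq) = contradiction (sym eq) (level-inT≢v {i = j} {x})
≺-trans (v⟶T {j = j} {x} _ , eq) _ = contradiction (sym eq) (level-inT≢v {i = j} {x})
≺-trans (T⟶v {i = i} {x} _ , eq) _ = contradiction eq (level-inT≢v {i = i} {x})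
≺-trans (T⟶T _ , _) (T⟶v {i = i} {x} _ , eq) = contradiction eq (level-inT≢v {i = i} {x})
≺-trans (inside _ , _) (T⟶v {i = i} {x} _ , eq) = contradiction eq (level-inT≢v {i = i} {x})
≺-trans (T⟶T p , e) (T⟶T q , e′) = T⟶T (<-trans p q) , trans e e′
≺-trans (T⟶T p , e) (inside _ , e′) = T⟶T p , trans e e′
≺-trans (inside _ , e) (T⟶T q , e′) = T⟶T q , trans e e′
≺-trans (inside p , e) (inside q , e′) with ≺-trans (p , e) (q , e′)
... | r , e″ = inside r , e″

-- Only the levels from C on are coloured and used: the number of levels met by
-- the cycles bounds the dichromatic number of their union from above.
MonochromaticCycle : ∀ {m k} C → (∀ (x : AVertex m) → .(C ≤ level x) → Fin k) → ℕ → Set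
MonochromaticCycle C g r =
  ∃[ c ] Σ[ Z ∈ Cycle _⟶ᴬ_ r ]
    (∀ i → Σ[ high ∈ C ≤ level (Cycle.at Z i) ] g (Cycle.at Z i) high ≡ c)

-- The cycle T_j → v_(d 0) → ⋯ → v_(d (L + 1)) → T_j, where j = d (L + 1) + 1.
throughCopy : ∀ {m L} (d : Fin (2 + L) → Fin (2 + m)) →
              (∀ {i j} → toℕ i < toℕ j → toℕ (d j) < toℕ (d i)) →
              (j : Fin (suc m)) → (∀ i → toℕ i ≡ suc L → toℕ (d i) ≡ toℕ j) →
              AVertex m → Cycle (_⟶ᴬ_ {suc m}) (3 + L)
throughCopy {m} {L} d d-dec j d-last x = record { at = at ; distinct = distinct _ _ ; step = step }
  where
  at : Fin (3 + L) → AVertex (suc m)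
  at zero    = inT j x
  at (suc i) = v (d i)

  d-injective : ∀ i i′ → d i ≡ d i′ → i ≡ i′
  d-injective i i′ eq = toℕ-injective (≤-antisym
    (≮⇒≥ λ i′<i → <⇒≢ (d-dec i′<i) (cong toℕ eq))
    (≮⇒≥ λ i<i′ → <⇒≢ (d-dec i<i′) (cong toℕ (sym eq))))

  distinct : ∀ i i′ → at i ≡ at i′ → i ≡ i′
  distinct zero    zero     _  = refl
  distinct (suc i) (suc i′) eq = cong suc (d-injective i i′ (v-injective eq))

  step : ∀ i → at i ⟶ᴬ at (next i)
  step zero with refl ← toℕ-injective {i = next {3 + L} zero} {suc zero} (next-< {2 + L} zero z<s) =
    -- `d zero` lies strictly above the last index, which is `toℕ j`, so it is at least
    -- `copyIndex j`.
    T⟶v (subst (_< toℕ (d zero)) (d-last last toℕ-last) (d-dec z<last))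
    where
    last : Fin (2 + L)
    last = fromℕ< ≤-refl
    toℕ-last : toℕ last ≡ suc L
    toℕ-last = toℕ-fromℕ< ≤-refl
    z<last : 0 < toℕ last
    z<last = subst (0 <_) (sym toℕ-last) z<s
  step (suc i) with m≤n⇒m<n∨m≡n (s≤s⁻¹ (toℕ<n i))
  ... | inj₁ i<L with next (suc i) | next-< (suc i) (s≤s i<L)
  ...   | suc i′ | eq = v⟶v (d-dec (subst (toℕ i <_) (sym (cong pred eq)) ≤-refl))
  step (suc i) | inj₂ i≡L rewrite next-last (suc i) (cong suc i≡L) =
    v⟶T (s≤s (≤-reflexive (d-last i i≡L)))

level-someVertex : ∀ n → level (someVertex n) ≡ n
level-someVertex zero    = refl
level-someVertex (suc n) = refl

opposite-anti : ∀ {n} {i j : Fin n} → toℕ i < toℕ j → toℕ (opposite j) < toℕ (opposite i)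
opposite-anti {n} {i} {j} i<j =
  subst₂ _<_ (sym (opposite-prop j)) (sym (opposite-prop i))
    (∸-monoʳ-< (s<s i<j) (toℕ<n j))

-- Either the copy T_j inside a long monochromatic clique meets its colour, or
-- one colour fewer is used in T_j.
longCycle : ∀ k L {C} → k * (2 + L) ≤ C →
            (g : (x : AVertex (k + C)) → .(C ≤ level x) → Fin k) →
            MonochromaticCycle C g (3 + L)
-- No colour is left, yet `A C` has a vertex of level `C` to be coloured.
longCycle zero    L {C} _ g with () ← g (someVertex C) (≤-reflexive (sym (level-someVertex C)))
longCycle (suc k) L {C} kL≤C g =
  -- `opposite` reverses the numbering because arcs run from larger to smaller indices.
  fromSelection (monochromaticSelection (suc k) (2 + L)
    (m≤n⇒m≤1+n (s≤s (≤-trans kL≤C (m≤n+m C k)))) λ i → g (v (opposite i)) high)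
  where
  high : C ≤ suc (k + C)
  high = m≤n+m C (suc k)

  module _ {c} (h : Fin (2 + L) → Fin (2 + (k + C))) (h-inc : Increasing h)
           (h-colour : ∀ i → g (v (opposite (h i))) high ≡ c) where
    d : Fin (2 + L) → Fin (2 + (k + C))
    d = opposite ∘ h

    d-dec : ∀ {i j} → toℕ i < toℕ j → toℕ (d j) < toℕ (d i)
    d-dec = opposite-anti ∘ h-inc

    last : Fin (2 + L)
    last = fromℕ< ≤-refl

    toℕ-last : toℕ last ≡ suc L
    toℕ-last = toℕ-fromℕ< ≤-refl

    -- The last index is below `d zero`, hence not the largest, and so names an existing copy.
    d-last< : toℕ (d last) < suc (k + C)
    d-last< = s≤s⁻¹ (≤-trans (s≤s (d-dec {zero} {last} (subst (0 <_) (sym toℕ-last) z<s)))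
                             (toℕ<n (d zero)))

    copy : Fin (suc (k + C))
    copy = fromℕ< d-last<

    Hit : AVertex (k + C) → Set
    Hit x = Σ[ high ∈ C ≤ level x ] g (inT copy x) high ≡ c

    hit? : ∀ x → Dec (Hit x)
    hit? x with C ≤? level x
    ... | no low    = no (low ∘ proj₁)
    ... | yes high  with g (inT copy x) high Fin.≟ c
    ...   | yes eq  = yes (high , eq)
    ...   | no  neq = no (neq ∘ proj₂)

    conclude : Dec (∃[ x ] Hit x) → MonochromaticCycle C g (3 + L)
    conclude (yes (x , hit)) =
      c , throughCopy d d-dec copy
            (λ i i≡ → trans (cong (toℕ ∘ d) (toℕ-injective (trans i≡ (sym toℕ-last))))
                            (sym (toℕ-fromℕ< d-last<))) x ,
      λ { zero → hit ; (suc i) → high , h-colour i }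
    conclude (no none)
      -- Colour `c` is absent from the levels of the copy from `C` on, so `punchOut` removes it from
      -- the palette.
      with c′ , Z , Z-ok ← longCycle k L (≤-trans (m≤n+m (k * (2 + L)) (2 + L)) kL≤C)
                             (λ x high → punchOut {i = c} {g (inT copy x) high}
                                (λ c≡ → none (x , recompute (C ≤? level x) high , sym c≡))) =
      punchIn c c′ , mapCycle (inT copy) (proj₂ ∘ inT-injective) inside Z ,
      λ i → proj₁ (Z-ok i) ,
            trans (sym (punchIn-punchOut _)) (cong (punchIn c) (proj₂ (Z-ok i)))

  fromSelection : ∃[ c ] Selection (2 + L) (λ i → g (v (opposite i)) high ≡ c) →
                  MonochromaticCycle C g (3 + L)
  fromSelection (c , h , h-inc , h-colour) =
    conclude h h-inc h-colour (finite⇒∃? (AVertex-finite (k + C)) (hit? h h-inc h-colour))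

-- Blow-ups

module BlowUp (M D : ℕ) where

  -- For positive `m`, the top stage of `A m` has `suc m` additional vertices, each becoming
  -- `suc M`. The root also becomes additional vertices, so even `A 0` needs a target of positive
  -- stage: hence the shift by `suc D`.
  Fits : ℕ → Set
  Fits m = suc m * suc M ≤ suc D

  shrink : ∀ {m} → Fits (suc m) → Fits m
  shrink = ≤-trans (m≤n+m _ (suc M))

  -- The vertex v_i becomes the M + 1 vertices v_(i(M+1)) , … , v_(i(M+1)+M), and
  -- the copy T_j is placed inside T_(j(M+1)).
  blowUp : ∀ {m} → .(Fits m) → AVertex m → Fin (suc M) → AVertex (m + suc D)
  blowUp fits root p =
    v (inject≤ p (≤-trans (≤-reflexive (sym (*-identityˡ (suc M)))) (m≤n⇒m≤1+n fits)))
  blowUp {suc m} fits (v i) p = v (inject≤ (combine i p) (≤-trans fits (m≤n+m (suc D) (2 + m))))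
  blowUp {suc m} fits (inT j x) p =
    inT (fromℕ< {M + toℕ j * suc M}
          (≤-trans (*-monoˡ-≤ (suc M) (<⇒≤ (s≤s (toℕ<n j))))
                   (≤-trans fits (m≤n+m (suc D) (suc m)))))
        (blowUp (shrink {m} fits) x p)

  blowUp-injective : ∀ {m} .(fits : Fits m) {x y : AVertex m} {p q} →
                     blowUp fits x p ≡ blowUp fits y q → x ≡ y × p ≡ q
  blowUp-injective fits {root} {root} eq = refl , inject≤-injective _ _ _ _ (v-injective eq)
  blowUp-injective fits {v i} {v j} eq
    with refl , eq′ ← combine-injective i _ j _ (inject≤-injective _ _ _ _ (v-injective eq)) =
    refl , eq′
  blowUp-injective {suc m} fits {inT i x} {inT j y} eq
    with eq₁ , eq₂ ← inT-injective eq
    with refl , p≡q ← blowUp-injective (shrink {m} fits) {x} {y} eq₂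
    with refl ← toℕ-injective {i = i} {j} (*-cancelʳ-≡ _ _ (suc M) (+-cancelˡ-≡ M _ _
                  (fromℕ<-injective (M + toℕ i * suc M) (M + toℕ j * suc M) _ _ eq₁))) =
    refl , p≡q

  private
    copyIndex-fromℕ< : ∀ {n} (j : Fin n) {o} .(q : M + toℕ j * suc M < o) →
                       copyIndex (fromℕ< q) ≡ copyIndex j * suc M
    copyIndex-fromℕ< j q = cong suc (toℕ-fromℕ< q)

    toℕ-blow : ∀ {n} (i : Fin n) (p : Fin (suc M)) {o} .(q : n * suc M ≤ o) →
               toℕ (inject≤ (combine i p) q) ≡ toℕ i * suc M + toℕ p
    toℕ-blow i p q = trans (toℕ-inject≤ _ q)
      (trans (toℕ-combine i p) (cong (_+ toℕ p) (*-comm (suc M) (toℕ i))))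

    block-< : ∀ {a b} (p : Fin (suc M)) → a < b → a * suc M + toℕ p < b * suc M
    block-< {a} {b} p a<b = begin-strict
      a * suc M + toℕ p   <⟨ +-monoʳ-< (a * suc M) (toℕ<n p) ⟩
      a * suc M + suc M   ≡⟨ +-comm (a * suc M) (suc M) ⟩
      suc a * suc M       ≤⟨ *-monoˡ-≤ (suc M) a<b ⟩
      b * suc M           ∎
      where open ≤-Reasoning

  -- Outside common copies, arcs depend only on comparing indices. The block of `v i` starts at
  -- `i(M+1)` and ends before `(i+1)(M+1)`, so the comparisons survive scaling by `M+1`.
  blowUp-arc : ∀ {m} .(fits : Fits m) {x y : AVertex m} p q →
               x ⟶ᴬ y → blowUp fits x p ⟶ᴬ blowUp fits y q
  blowUp-arc fits p q (v⟶v {i = i} {j} i<j) =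
    v⟶v (subst₂ _<_ (sym (toℕ-blow i q _)) (sym (toℕ-blow j p _))
      (≤-trans (block-< q i<j) (m≤m+n _ (toℕ p))))
  blowUp-arc fits p q (v⟶T {i = i} {j} i<j) =
    v⟶T (subst₂ _<_ (sym (toℕ-blow i p _)) (sym (copyIndex-fromℕ< j _)) (block-< p i<j))
  blowUp-arc fits p q (T⟶v {i = i} {j = j} i≤j) =
    T⟶v (subst₂ _≤_ (sym (copyIndex-fromℕ< i _)) (sym (toℕ-blow j q _))
      (≤-trans (*-monoˡ-≤ (suc M) i≤j) (m≤m+n _ (toℕ q))))
  blowUp-arc fits p q (T⟶T {i = i} {j} i<j) =
    T⟶T (subst₂ _<_ (sym (copyIndex-fromℕ< i _)) (sym (copyIndex-fromℕ< j _))
      (*-monoˡ-< (suc M) i<j))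
  blowUp-arc {suc m} fits p q (inside a) = inside (blowUp-arc (shrink {m} fits) p q a)

  level-blowUp : ∀ {m} .(fits : Fits m) (x : AVertex m) p →
                 level (blowUp fits x p) ≡ level x + suc D
  level-blowUp fits root      p = refl
  level-blowUp {suc m} fits (inT j x) p = level-blowUp (shrink {m} fits) x p
  level-blowUp fits (v i)     p = refl

-- Unions of cycles along a sparse system

module _ {W X X′ : Set} {_∋_ : W → X → Set} {_∋′_ : W → X′ → Set} (e : X → X′)
         (e-injective : Injective _≡_ _≡_ e)
         (lift : ∀ {w x′} → w ∋′ x′ → ∃[ x ] w ∋ x × e x ≡ x′) where

  -- Injectivity of `e` identifies the two lifts of a vertex shared by consecutive words.
  liftWalk : ∀ {w w′ x′ s} → Walk _∋′_ w w′ x′ s → ∃[ x ] e x ≡ x′ × Walk _∋_ w w′ x s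
  liftWalk (start p q w≢w′)
    with x , w∋x , refl ← lift p | y , w′∋y , eq ← lift q
    with refl ← e-injective eq = x , refl , start w∋x w′∋y w≢w′
  liftWalk (extend W x≢x′ p q w≢w′)
    with z , refl , V ← liftWalk W | x , w∋x , refl ← lift p | y , w′∋y , eq ← lift q
    with refl ← e-injective eq = x , refl , extend V (x≢x′ ∘ cong e) w∋x w′∋y w≢w′

  sparse-image : ∀ {ℓ} → Sparse _∋_ ℓ → Sparse _∋′_ ℓ
  sparse-image sparse s≤ℓ W = sparse s≤ℓ (proj₂ (proj₂ (liftWalk W)))

module CycleSystem {W X : Set} (_≟_ : DecidableEquality W) {r}
                   (pt : W → Fin r → X) (pt-injective : ∀ w → Injective _≡_ _≡_ (pt w)) where

  _∋_ : W → X → Set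
  w ∋ x = ∃[ i ] pt w i ≡ x

  Edge : X → X → Set
  Edge x y = ∃[ w ] ∃[ i ] x ≡ pt w i × y ≡ pt w (next i)

  EdgeOf : W → X → X → Set
  EdgeOf w x y = ∃[ i ] ((x ≡ pt w i × y ≡ pt w (next i)) ⊎ (y ≡ pt w i × x ≡ pt w (next i)))

  -- Run w q p x b: a walk of length b along the cycle of w in a constant
  -- direction, from q to x, with p the last vertex before x.
  data Run (w : W) : X → X → X → ℕ → Set where
    forward  : ∀ i b → Run w (pt w i) (pt w (rotate b i)) (pt w (rotate (suc b) i)) (suc b)
    backward : ∀ i b → Run w (pt w (rotate (suc b) i)) (pt w (next i)) (pt w i) (suc b)

  run-moves : ∀ {w q p x b} → b < r → Run w q p x b → q ≢ x
  run-moves b<r (forward i b)  eq = rotate-moves i z<s b<r (sym (pt-injective _ eq))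
  run-moves b<r (backward i b) eq = rotate-moves i z<s b<r (pt-injective _ eq)

  run-end : ∀ {w q p x b} → Run w q p x b → w ∋ x
  run-end (forward i b)  = rotate (suc b) i , refl
  run-end (backward i b) = i , refl

  run-start : ∀ {w q p x b} → Run w q p x b → w ∋ q
  run-start (forward i b)  = i , refl
  run-start (backward i b) = rotate (suc b) i , refl

  run-nonempty : ∀ {w q p x b} → Run w q p x b → 1 ≤ b
  run-nonempty (forward _ _)  = z<s
  run-nonempty (backward _ _) = z<s

  newRun : ∀ {w x y} → EdgeOf w x y → Run w x x y 1
  newRun (i , inj₁ (refl , refl)) = forward i 0
  newRun (i , inj₂ (refl , refl)) = backward i 0

  -- Of the two edges of the cycle at `x`, one leads back to `p` and the other continues the run.
  extendRun : ∀ {w q p x y b} → Run w q p x b → p ≢ y → EdgeOf w x y → Run w q x y (suc b)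
  extendRun (forward i b) p≢y (j , inj₁ (eq , refl))
    with refl ← pt-injective _ eq = forward i (suc b)
  extendRun (forward i b) p≢y (j , inj₂ (refl , eq)) =
    contradiction (cong (pt _) (next-injective (pt-injective _ eq))) p≢y
  extendRun (backward i b) p≢y (j , inj₁ (eq , refl))
    with refl ← pt-injective _ eq = contradiction refl p≢y
  extendRun {w} (backward i b) p≢y (j , inj₂ (refl , eq))
    with refl ← pt-injective _ eq =
    subst (λ h → Run w (pt w h) (pt w (next j)) (pt w j) (2 + b))
          (sym (rotate-next (suc b) j)) (backward j (suc b))

  -- A walk in the union is cut where it changes cycle; `q` is the last such vertex. Each earlier
  -- run has at least one edge, so `t` is bounded by the number of edges before `q`.
  data Trace (x₀ p x : X) (s : ℕ) : Set where
    single : ∀ {w} → Run w x₀ p x s → Trace x₀ p x s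
    many   : ∀ {w₀ w q t b} → w₀ ∋ x₀ → Walk _∋_ w₀ w q t → Run w q p x b → t + b ≤ s →
             Trace x₀ p x s

  extendTrace : ∀ {x₀ p x y s w} → s < r → Trace x₀ p x s → p ≢ y → EdgeOf w x y →
                Trace x₀ x y (suc s)
  extendTrace {w = w} s<r (single {w′} R) p≢y a with w′ ≟ w
  ... | yes refl = single (extendRun R p≢y a)
  ... | no  w′≢w = many (run-start R)
                     (start (run-end R) (run-start (newRun a)) w′≢w) (newRun a)
                     (s≤s (run-nonempty R))
  extendTrace {w = w} s<r (many {w = w′} {t = t} {b} w₀∋x₀ V R t+b≤s) p≢y a with w′ ≟ w
  ... | yes refl = many w₀∋x₀ V (extendRun R p≢y a)
                     (≤-trans (≤-reflexive (+-suc t b)) (s≤s t+b≤s))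
  ... | no  w′≢w = many w₀∋x₀
                     -- A run shorter than its cycle has distinct ends, so the walk of words does
                     -- not backtrack.
                     (extend V (run-moves (≤-<-trans (≤-trans (m≤n+m b t) t+b≤s) s<r) R)
                               (run-end R) (run-start (newRun a)) w′≢w)
                     (newRun a)
                     (s≤s (≤-trans (+-monoʳ-≤ t (run-nonempty R)) t+b≤s))

  module _ {ℓ} (sparse : Sparse _∋_ ℓ) (ℓ<r : ℓ < r) where

    -- A single run is too short to close. Otherwise the walk of words is closed already, or becomes
    -- so by one more step through `x₀`, paid for by the nonempty last run.
    noClosedTrace : ∀ {x₀ p s} → s ≤ ℓ → ¬ Trace x₀ p x₀ s
    noClosedTrace s≤ℓ (single R) = run-moves (≤-<-trans s≤ℓ ℓ<r) R refl
    noClosedTrace s≤ℓ (many {w₀} {w} {t = t} {b} w₀∋x₀ V R t+b≤s) with w ≟ w₀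
    ... | yes refl = sparse (≤-trans (m≤m+n t b) (≤-trans t+b≤s s≤ℓ)) V
    ... | no  w≢w₀ = sparse
      (≤-trans (≤-reflexive (+-comm 1 t))
               (≤-trans (+-monoʳ-≤ t (run-nonempty R)) (≤-trans t+b≤s s≤ℓ)))
      (extend V (run-moves (≤-<-trans (≤-trans (m≤n+m b t) (≤-trans t+b≤s s≤ℓ)) ℓ<r) R)
              (run-end R) w₀∋x₀ w≢w₀)

    noShortCycle : ∀ {s} → 3 ≤ s → s ≤ ℓ → ¬ Cycle (λ x y → Edge x y ⊎ Edge y x) s
    noShortCycle {suc s} 3≤s s≤ℓ Z =
      noClosedTrace s≤ℓ (subst (λ i → Trace (at zero) (x s) (at i) (suc s)) (rotate-full zero)
                               (trace s ≤-refl))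
      where
      open Cycle Z

      x : ℕ → X
      x j = at (rotate j zero)

      edge : ∀ j → ∃[ w ] EdgeOf w (x j) (x (suc j))
      edge j with step (rotate j zero)
      ... | inj₁ (w , i , p) = w , i , inj₁ p
      ... | inj₂ (w , i , p) = w , i , inj₂ p

      trace : ∀ j → suc j ≤ suc s → Trace (x 0) (x j) (x (suc j)) (suc j)
      trace zero    _ = single (newRun (proj₂ (edge 0)))
      trace (suc j) j≤s =
        extendTrace (≤-<-trans (≤-trans (<⇒≤ j≤s) s≤ℓ) ℓ<r) (trace j (<⇒≤ j≤s))
          -- In a cycle of length at least 3, the vertex two steps ahead is a different one.
          (λ eq → rotate-moves {b = 2} (rotate j zero) z<s 3≤s (sym (distinct eq)))
          (proj₂ (edge (suc j)))

-- The subdigraph, its dichromatic number and its girth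

induced-arc : ∀ D P {x y} → T (P x) → T (P y) → Digraph._⟶_ D x y →
              T (Subdigraph.arc (induced D P) x y)
induced-arc D P {x} {y} p q a =
  Equivalence.from (T-∧ {P x ∧ P y})
    (Equivalence.from (T-∧ {P x}) (p , q) , fromWitness {a? = Digraph._⟶?_ D x y} a)

module Construction (k L : ℕ) where

  K C m : ℕ
  -- Even for `k = 0` a colour must exist, to obtain `someWord` and its cycle.
  K = suc k
  C = K * (2 + L)
  m = K + C

  open Inverse (proj₂ (AVertex-finite m)) using () renaming
    (to to number; from to vertexAt; strictlyInverseʳ to vertexAt-number)

  open System (system K (suc L) (proj₁ (AVertex-finite m)))

  open Inverse (proj₂ node-finite) using () renaming
    (to to code; strictlyInverseʳ to decode-code; from to decode)

  M D n : ℕ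
  M = proj₁ node-finite
  D = suc m * suc M
  n = m + suc D

  open BlowUp M D

  fits : Fits m
  fits = n≤1+n D

  -- The part of `t` is realised inside the block of `t`, so a cycle of `A m` carries over to any
  -- choice of nodes.
  place : AVertex m → Node → AVertex n
  place t p = blowUp fits t (inject₁ (code p))

  place-injective : ∀ {t t′ p p′} → place t p ≡ place t′ p′ → t ≡ t′ × p ≡ p′
  place-injective {p = p} {p′} eq with t≡t′ , c≡c′ ← blowUp-injective fits eq =
    t≡t′ , trans (sym (decode-code p))
                 (trans (cong decode (inject₁-injective c≡c′)) (decode-code p′))

  chosen : ∀ w → MonochromaticCycle {m} C (λ t _ → colour w (number t)) (3 + L)
  chosen w = longCycle K L ≤-refl (λ t _ → colour w (number t))

  module Chosen w = Cycle (proj₁ (proj₂ (chosen w)))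

  pt : Word → Fin (3 + L) → AVertex n
  pt w i = place (Chosen.at w i) (node w (number (Chosen.at w i)))

  pt-injective : ∀ w → Injective _≡_ _≡_ (pt w)
  pt-injective w = Chosen.distinct w ∘ proj₁ ∘ place-injective

  pt-level : ∀ w i → C + suc D ≤ level (pt w i)
  pt-level w i = ≤-trans (+-monoˡ-≤ (suc D) (proj₁ (proj₂ (proj₂ (chosen w)) i)))
    (≤-reflexive (sym (level-blowUp fits (Chosen.at w i) _)))

  open CycleSystem (finite⇒≟ word-finite) pt pt-injective

  ∋-sparse : Sparse _∋_ (2 + L)
  ∋-sparse = sparse-image (λ (i , p) → place (vertexAt i) p) e-injective
    (λ { {w} (i , refl) → (number (Chosen.at w i) , node w (number (Chosen.at w i))) , refl ,
           cong (λ t → place t (node w (number (Chosen.at w i)))) (vertexAt-number _) })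
    sparse
    where
    open Inverse (proj₂ (AVertex-finite m)) using (strictlyInverseˡ)
    e-injective : Injective _≡_ _≡_ (λ (i , p) → place (vertexAt i) p)
    e-injective {i , p} {j , q} eq with t≡ , p≡q ← place-injective eq =
      cong₂ _,_ (trans (sym (strictlyInverseˡ i)) (trans (cong number t≡) (strictlyInverseˡ j))) p≡q

  edge? : ∀ x y → Dec (Edge x y)
  edge? x y = finite⇒∃? word-finite λ w → any? λ i →
    finite⇒≟ (AVertex-finite n) x (pt w i) ×-dec finite⇒≟ (AVertex-finite n) y (pt w (next i))

  edge⇒⟶ : ∀ {x y} → Edge x y → x ⟶ᴬ y
  edge⇒⟶ (w , i , refl , refl) = blowUp-arc fits _ _ (Chosen.step w i)

  S : Subdigraph (A n)
  S = record
    { vertex = λ _ → true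
    ; arc    = λ x y → ⌊ edge? x y ⌋
    ; source = λ _ → tt
    ; target = λ _ → tt
    ; sound  = λ {x} {y} a → edge⇒⟶ (toWitness {a? = edge? x y} a)
    }

  layer< : ∀ (x : AVertex n) → level x ∸ (C + suc D) < suc K
  layer< x = s≤s (≤-trans (∸-monoˡ-≤ (C + suc D) (level≤ x))
    (≤-reflexive (trans (cong (_∸ (C + suc D)) (+-assoc K C (suc D))) (m+n∸n≡m K (C + suc D)))))

  -- Truncated subtraction sends all low levels to layer zero; this is harmless because ends of
  -- edges have level at least `C + suc D`.
  layer : AVertex n → Fin (suc K)
  layer x = fromℕ< (layer< x)

  edge-layer : ∀ {x y} → Edge x y → layer x ≡ layer y → x ≺ y
  edge-layer {x} {y} a@(w , i , refl , refl) eq = edge⇒⟶ a ,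
    ∸-cancelʳ-≡ (pt-level w i) (pt-level w (next i))
      (fromℕ<-injective _ _ (layer< x) (layer< y) eq)

  layers-acyclic : AcyclicPartition ⟦ S ⟧ (suc K)
  layers-acyclic = layer ∘ proj₁ , λ i s 1≤s → noCycle ≺-trans ≺-irrefl (proj₁ ∘ proj₁)
    (λ {x} {y} a → edge-layer (toWitness {a? = edge? _ _} (Subdigraph.sound (class i) a))
      (trans (toWitness (proj₂ x)) (sym (toWitness (proj₂ y))))) 1≤s
    where
    class : Fin (suc K) → Subdigraph ⟦ S ⟧
    class i = induced ⟦ S ⟧ (λ x → ⌊ layer (proj₁ x) Fin.≟ i ⌋)

  -- At most `K` parts would give a `K`-colouring of the nodes; the word realising it has its chosen
  -- cycle inside one part.
  notFewer : ∀ d → AcyclicPartition ⟦ S ⟧ d → suc K ≤ d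
  notFewer d (part , acyclic) = ≮⇒≥ λ d<1+K → impossible (s≤s⁻¹ d<1+K)
    where
    impossible : ¬ d ≤ K
    impossible d≤K
      with w , realised ← realise (λ i p → inject≤ (part (place (vertexAt i) p , tt)) d≤K) =
      acyclic i₀ (3 + L) z<s record
        { at = λ i → (pt w i , tt) , fromWitness (same i)
        ; distinct = pt-injective w ∘ cong (proj₁ ∘ proj₁)
        ; step = λ i → induced-arc ⟦ S ⟧ (λ x → ⌊ part x Fin.≟ i₀ ⌋)
            (fromWitness (same i)) (fromWitness (same (next i))) (fromWitness (w , i , refl , refl))
        }
      where
      i₀ : Fin d
      i₀ = part (pt w zero , tt)

      colour-pt : ∀ i → inject≤ (part (pt w i , tt)) d≤K ≡ proj₁ (chosen w)
      colour-pt i = trans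
        (cong (λ t → inject≤ (part (place t (node w (number (Chosen.at w i))) , tt)) d≤K)
              (sym (vertexAt-number (Chosen.at w i))))
        (trans (realised (number (Chosen.at w i))) (proj₂ (proj₂ (proj₂ (chosen w)) i)))

      same : ∀ i → part (pt w i , tt) ≡ i₀
      same i = inject≤-injective d≤K d≤K _ _ (trans (colour-pt i) (sym (colour-pt zero)))

  someWord : Word
  someWord = proj₁ (realise λ _ _ → zero)

  wordCycle : UnderlyingCycle ⟦ S ⟧ (3 + L)
  wordCycle = s≤s (s≤s (s≤s z≤n)) , record
    { at = λ i → pt someWord i , tt
    ; distinct = pt-injective someWord ∘ cong proj₁
    ; step = λ i → inj₁ (fromWitness (someWord , i , refl , refl))
    }

  noShorter : ∀ s → UnderlyingCycle ⟦ S ⟧ s → 3 + L ≤ s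
  noShorter s (3≤s , Z) = ≮⇒≥ λ s<3+L →
    noShortCycle ∋-sparse ≤-refl 3≤s (s≤s⁻¹ s<3+L)
      (mapCycle proj₁ (cong (_, tt)) adjacent Z)
    where
    adjacent : ∀ {x y} → Adjacent ⟦ S ⟧ x y → Edge (proj₁ x) (proj₁ y) ⊎ Edge (proj₁ y) (proj₁ x)
    adjacent (inj₁ a) = inj₁ (toWitness a)
    adjacent (inj₂ a) = inj₂ (toWitness a)

proposition11 : (k ℓ : ℕ) → 3 ≤ ℓ →
    Σ[ n ∈ ℕ ] Σ[ S ∈ Subdigraph (A n) ]
    ((Σ[ d ∈ ℕ ] (IsDichromaticNumber ⟦ S ⟧ d × k < d)) ×
    (Σ[ g ∈ ℕ ⁺ ] (IsGirth ⟦ S ⟧ g × [ ℓ ] <⁺ g)))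
proposition11 k (suc (suc L)) (s≤s (s≤s _)) =
  -- The dichromatic number is `suc K`, and the girth `3 + L` is `suc ℓ`.
  n , S , (suc (suc k) , (layers-acyclic , notFewer) , m<n⇒m<1+n ≤-refl) ,
  [ 3 + L ] , IsGirth.finite (wordCycle , noShorter) , Strict.[ ≤-refl ]
  where open Construction k L
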